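{- For every finite graph $H$, $$\mathrm{Hom}(H)\ \leq_{\mathrm P}^{\mathrm{Tur}}\ \mathrm{Ful\text{ - }Rel}(H)\ \leq_{\mathrm P}^{\mathrm{Tur}}\ \mathrm{Sur\text{ - }Hom}(H).$$
   Context: Graphs are finite and undirected, loops allowed. For a finite set $B$ and a relation $R\subseteq V_G\times B$ with full image (every $b\in B$ has some $v$ with $(v,b)\in R$), $G\ast R$ is the graph with vertex set $B$ and edge set $\{(a,b)\in B\times B: \exists (u,v)\in E_G,\ (u,a)\in R,\ (v,b)\in R\}$. $R$ has full domain if every $v\in V_G$ is related to some $b\in B$. A homomorphism $f:G\to H$ is surjective if it is surjective on vertices and every edge $(a,b)\in E_H$ equals $(f(u),f(v))$ for some $(u,v)\in E_G$. For a fixed graph $H$, each of the following decision problems takes as input a finite graph $G$. $\mathrm{Hom}(H)$: is there a homomorphism from $G$ to $H$? $\mathrm{Ful\text{ - }Rel}(H)$: is there a relation $R\subseteq V_G\times V_H$ with full domain such that $G\ast R=H$? $\mathrm{Sur\text{ - }Hom}(H)$: is there a surjective homomorphism from $G$ to $H$? $L\leq_{\mathrm P}^{\mathrm{Tur}}L'$ (polynomial-time reducibility) means there is a function $f$ computable in polynomial time such that for every input $x$: $x\in L$ if and only if $f(x)\in L'$. -}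

module Defs where

open import Data.Bool using (Bool; T)
open import Data.Bool.Properties using (T?)
open import Data.Fin using (Fin; zero; suc)
open import Data.Fin.Properties using (any?)
open import Data.List using (List; []; _∷_; _++_; [_]; map; concat; foldr; length; replicate; reverse; tabulate)
open import Data.Maybe using (Maybe; just; nothing)
open import Data.Nat using (ℕ; suc; _+_; _*_; _≤_)
open import Data.Product using (_×_; _,_; ∃; ∃₂)
open import Data.Sum using (_⊎_; inj₁; inj₂)
open import Data.Vec as Vec using (Vec; _∷_)
open import Function using (_⇔_; mk⇔; _↔_)
open import Function.Definitions using (StrictlySurjective)
open import Relation.Binary using (Rel; Decidable; _Preserves_⟶_)
open import Relation.Binary.PropositionalEquality using (_≡_; subst)
open import Relation.Nullary using (does; _×-dec_)
open import Relation.Nullary.Decidable using (does-⇔)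
open import Level using (0ℓ)

record Graph : Set where
  field
    order     : ℕ
    adj       : Fin order → Fin order → Bool
    symmetric : ∀ u v → adj u v ≡ adj v u

open Graph public

V : Graph → Set
V G = Fin (order G)

E : (G : Graph) → Rel (V G) 0ℓ
E G u v = T (adj G u v)

-- A subset of a finite product is a Boolean matrix.
Relation : ℕ → ℕ → Set
Relation m n = Fin m → Fin n → Bool

FullDomain : ∀ {m n} → Relation m n → Set
FullDomain R = ∀ v → ∃ λ b → T (R v b)

FullImage : ∀ {m n} → Relation m n → Set
FullImage R = ∀ b → ∃ λ v → T (R v b)

module _ (G : Graph) {n : ℕ} (R : Relation (order G) n) where

  ∗-Edge : Rel (Fin n) 0ℓ
  ∗-Edge a b = ∃₂ λ u v → E G u v × T (R u a) × T (R v b)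

  ∗-Edge? : Decidable ∗-Edge
  ∗-Edge? a b = any? λ u → any? λ v →
    T? (adj G u v) ×-dec T? (R u a) ×-dec T? (R v b)

  ∗-Edge-sym : ∀ {a b} → ∗-Edge a b → ∗-Edge b a
  ∗-Edge-sym (u , v , uv , ua , vb) =
    v , u , subst T (symmetric G u v) uv , vb , ua

  -- The mathematical operation is only used for R with full image; that
  -- hypothesis is a separate conjunct wherever the operation appears.
  _∗_ : Graph
  _∗_ = record
    { order     = n
    ; adj       = λ a b → does (∗-Edge? a b)
    ; symmetric = λ a b →
        does-⇔ (mk⇔ ∗-Edge-sym ∗-Edge-sym) (∗-Edge? a b) (∗-Edge? b a)
    }

IsHom : (G H : Graph) → (V G → V H) → Set
IsHom G H f = f Preserves E G ⟶ E H

record IsSurjectiveHom (G H : Graph) (f : V G → V H) : Set where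
  field
    isHom          : IsHom G H f
    vertices-cover : StrictlySurjective _≡_ f
    edges-cover    : ∀ {a b} → E H a b →
                     ∃₂ λ u v → E G u v × a ≡ f u × b ≡ f v

GraphProblem : Set₁
GraphProblem = Graph → Set

Hom : Graph → GraphProblem
Hom H G = ∃ λ (f : V G → V H) → IsHom G H f

-- G ∗ R and H have the same vertex set by typing, so G ∗ R = H amounts to
-- equality of their adjacency matrices, stated entrywise.
FulRel : Graph → GraphProblem
FulRel H G = ∃ λ (R : Relation (order G) (order H)) →
  FullDomain R × FullImage R × (∀ a b → adj (G ∗ R) a b ≡ adj H a b)

SurHom : Graph → GraphProblem
SurHom H G = ∃ λ (f : V G → V H) → IsSurjectiveHom G H f

data Move : Set where
  left stay right : Move

-- A two-way infinite tape, all but finitely many of whose cells are blank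
-- (nothing).  The list to the left of the head is stored nearest cell
-- first; cells beyond either list are blank.
record Tape (Γ : Set) : Set where
  constructor tape
  field
    before : List (Maybe Γ)
    here   : Maybe Γ
    after  : List (Maybe Γ)

module _ {Γ : Set} where

  emptyTape : Tape Γ
  emptyTape = tape [] nothing []

  -- The head starts on the first symbol of the word.
  load : List Γ → Tape Γ
  load []       = emptyTape
  load (x ∷ xs) = tape [] (just x) (map just xs)

  move : Move → Tape Γ → Tape Γ
  move left  (tape []       x rs)       = tape []       nothing (x ∷ rs)
  move left  (tape (l ∷ ls) x rs)       = tape ls       l       (x ∷ rs)
  move stay  t                          = t
  move right (tape ls       x [])       = tape (x ∷ ls) nothing []
  move right (tape ls       x (r ∷ rs)) = tape (x ∷ ls) r       rs

  act : Maybe Γ × Move → Tape Γ → Tape Γ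
  act (y , m) (tape ls _ rs) = move m (tape ls y rs)

  -- The tape carries the word w on consecutive cells and is blank elsewhere;
  -- the head may be anywhere.
  Holds : Tape Γ → List Γ → Set
  Holds (tape ls x rs) w = ∃₂ λ i j →
    reverse ls ++ x ∷ rs ≡ replicate i nothing ++ map just w ++ replicate j nothing

data Symbol : Set where
  bit : Bool → Symbol
  sep : Symbol

-- Deterministic and multi-tape, with input/output alphabet Symbol, extra
-- further tape symbols, and the blank.  Tape 0 is the input tape, tape 1 the
-- output tape, and there are workTapes others.
record TuringMachine : Set₁ where
  field
    State     : Set
    finite    : ∃ λ n → State ↔ Fin n
    start     : State
    workTapes : ℕ
    extra     : ℕ

  Γ : Set
  Γ = Symbol ⊎ Fin extra

  tapes : ℕ
  tapes = 2 + workTapes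

  -- δ q xs ≡ nothing means that the machine halts.
  field
    δ : State → Vec (Maybe Γ) tapes →
        Maybe (State × Vec (Maybe Γ × Move) tapes)

  Configuration : Set
  Configuration = State × Vec (Tape Γ) tapes

  initial : List Symbol → Configuration
  initial w = start , load (map inj₁ w) ∷ Vec.replicate _ emptyTape

  step : Configuration → Maybe Configuration
  step (q , ts) with δ q (Vec.map Tape.here ts)
  ... | nothing       = nothing
  ... | just (q′ , as) = just (q′ , Vec.zipWith act as ts)

  -- c ⇓⟨ t ⟩ d : started in c, the machine halts in d after exactly t steps.
  data _⇓⟨_⟩_ : Configuration → ℕ → Configuration → Set where
    halt : ∀ {c} → step c ≡ nothing → c ⇓⟨ 0 ⟩ c
    next : ∀ {c c′ d t} → step c ≡ just c′ → c′ ⇓⟨ t ⟩ d → c ⇓⟨ suc t ⟩ d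

  Outputs : Configuration → List Symbol → Set
  Outputs (_ , ts) w = Holds (Vec.lookup ts (suc zero)) (map inj₁ w)

-- Coefficients in increasing degree.
Polynomial : Set
Polynomial = List ℕ

eval : Polynomial → ℕ → ℕ
eval p x = foldr (λ a r → a + x * r) 0 p

-- The adjacency matrix row by row, each row terminated by sep.
encode : Graph → List Symbol
encode G = concat (tabulate λ u → tabulate (λ v → bit (adj G u v)) ++ [ sep ])

PolyTimeComputable : (Graph → Graph) → Set₁
PolyTimeComputable f =
  ∃ λ (M : TuringMachine) → let open TuringMachine M in
  ∃ λ (p : Polynomial) → ∀ G → ∃₂ λ t d →
    initial (encode G) ⇓⟨ t ⟩ d
    × t ≤ eval p (length (encode G))
    × Outputs d (encode (f G))

infix 4 _≤ₚ_

-- Many-one reducibility, despite the superscript "Tur" used for it in the source.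
_≤ₚ_ : GraphProblem → GraphProblem → Set₁
L ≤ₚ L′ = ∃ λ (f : Graph → Graph) →
  PolyTimeComputable f × (∀ G → L G ⇔ L′ (f G))

{-# OPTIONS --safe #-}
module Submission where

-- G maps to H iff (H ⊔ G) ∗ R = H for some R with full domain: a homomorphism
-- together with the identity of H is such an R, and conversely any choice
-- function of R maps every edge into H.
-- G ∗ R = H for some R with full domain iff the blow-up of G, with every vertex
-- replaced by 1 + |H| copies, maps onto H: send the copies of v to the
-- various elements of R(v); conversely relate v to the images of its copies.
-- Both constructions are computed in linear time by a two-way transducer: one
-- sweeps the first row of G once per vertex of H, writing a zero per cell; the
-- other reads every row of G once per copy.

open import Defs
open import Data.Bool using (Bool; true; false; T; if_then_else_)
open import Data.Bool.Properties using (T?)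
open import Data.Fin
  using (Fin; zero; suc; toℕ; fromℕ; inject₁; _≟_; splitAt; _↑ˡ_; _↑ʳ_; combine; remQuot; quotient)
open import Data.Fin.Induction using (<-weakInduction; >-weakInduction)
open import Data.Fin.Properties
  using (any?; toℕ-fromℕ; toℕ-fromℕ<; toℕ-inject₁; splitAt-↑ˡ; splitAt-↑ʳ;
         remQuot-combine; combine-remQuot; +↔⊎; *↔×)
open import Data.Fin.Relation.Unary.Top using (View; view; view-fromℕ; view-inject₁; ‵fromℕ; ‵inject₁)
open import Data.List
  using (List; []; _∷_; _++_; _ʳ++_; [_]; map; concat; concatMap; drop; length; replicate; reverse; tabulate)
open import Data.List.Properties
  using (++-assoc; ++-identityʳ; length-++; length-map; length-tabulate; length-replicate;
         map-++; map-tabulate; map-replicate; map-concatMap; concatMap-++; concatMap-cong;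
         concatMap-map; concatMap-pure; reverse-++; reverse-involutive; tabulate-cong)
open import Data.Maybe as Maybe using (Maybe; just; nothing)
open import Data.Nat using (ℕ; zero; suc; _+_; _*_; _≤_; z≤n; s≤s)
open import Data.Nat.DivMod using (_mod_; m<n⇒m%n≡m)
open import Data.Nat.Properties hiding (_≟_)
open import Data.Nat.Tactic.RingSolver using (solve-∀)
open import Data.Product using (_×_; _,_; ∃; ∃₂; proj₁; proj₂)
open import Data.Product.Function.NonDependent.Propositional using (_×-↔_)
open import Data.Sum using (_⊎_; inj₁; inj₂; [_,_]′)
open import Data.Sum.Function.Propositional using (_⊎-cong_)
open import Data.Vec as Vec using (Vec; []; _∷_)
open import Function using (_∘_; _↔_; _⇔_; mk⇔; Equivalence; const; id)
open import Function.Construct.Composition using (_↔-∘_)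
open import Function.Construct.Identity using (↔-id)
open import Function.Construct.Symmetry using (↔-sym)
open import Relation.Binary.PropositionalEquality hiding ([_])
open import Relation.Nullary using (Dec; yes; no; does)
open import Relation.Nullary.Decidable using (does-⇔)

-- Two-way transducers and their simulation by Turing machines

Letter : Set
Letter = Symbol ⊎ Fin 0

Cell : Set
Cell = Maybe Letter

pattern ⟪_⟫ s = just (inj₁ s)

cells : List Symbol → List Cell
cells w = map just (map inj₁ w)

cells-++ : ∀ v w → cells (v ++ w) ≡ cells v ++ cells w
cells-++ v w = trans (cong (map just) (map-++ inj₁ v w)) (map-++ just (map inj₁ v) (map inj₁ w))

-- Allowing an empty second list puts the head on the blank just past the stored cells, so the end
-- of a word needs no separate treatment.
at : List Cell → List Cell → Tape Letter
at ls []       = tape ls nothing []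
at ls (x ∷ rs) = tape ls x rs

move-right : ∀ ls x rs → move right (tape ls x rs) ≡ at (x ∷ ls) rs
move-right ls x []       = refl
move-right ls x (_ ∷ rs) = refl

move-left-at : ∀ ls c xs x rs → move left (at (c ∷ ls) (xs ++ x ∷ rs)) ≡ tape ls c (xs ++ x ∷ rs)
move-left-at ls c []      x rs = refl
move-left-at ls c (_ ∷ _) x rs = refl

-- Cells beyond the stored list are blank, so a left move cannot tell whether that blank is stored.
-- This makes the blank before the input an explicit cell.
move-left-blank : ∀ xs → move left (at [] xs) ≡ move left (at (nothing ∷ []) xs)
move-left-blank []      = refl
move-left-blank (_ ∷ _) = refl

load-at : ∀ w → load (map inj₁ w) ≡ at [] (cells w)
load-at []      = refl
load-at (_ ∷ _) = refl

drop-length-++ : ∀ {A : Set} (v u : List A) → drop (length v) (v ++ u) ≡ u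
drop-length-++ []      u = refl
drop-length-++ (_ ∷ v) u = drop-length-++ v u

-- One transition both writes a whole word and moves the head on the input, which
-- is never overwritten.
record Transducer : Set₁ where
  field
    State   : Set
    finite  : ∃ λ n → State ↔ Fin n
    start   : State
    τ       : State → Cell → Maybe (State × Move × List Symbol)
    bound   : ℕ
    bounded : ∀ q x {q′ m w} → τ q x ≡ just (q′ , m , w) → length w ≤ bound

  -- The number is only an upper bound on the steps, since done may carry any.
  data Run : State × Tape Letter → List Symbol → ℕ → State × Tape Letter → Set where
    done : ∀ {c n} → Run c [] n c
    _then_ : ∀ {q q′ t m v w n d} → τ q (Tape.here t) ≡ just (q′ , m , v) →
             Run (q′ , move m t) w n d → Run (q , t) (v ++ w) (suc n) d

  infixr 5 _then_ _⨾_

  weaken : ∀ {c w m n d} → m ≤ n → Run c w m d → Run c w n d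
  weaken _         done       = done
  weaken (s≤s m≤n) (e then r) = e then weaken m≤n r

  from : ∀ {q t t′ w n d} → t ≡ t′ → Run (q , t′) w n d → Run (q , t) w n d
  from refl r = r

  writing : ∀ {c v w n d} → v ≡ w → Run c v n d → Run c w n d
  writing refl r = r

  _⨾_ : ∀ {c v m d w n e} → Run c v m d → Run d w n e → Run c (v ++ w) (m + n) e
  _⨾_ {m = m} {n = n} done s = weaken (m≤n+m n m) s
  _⨾_ {w = w} (_then_ {v = v} {w = v′} e r) s =
    writing (sym (++-assoc v v′ w)) (e then (r ⨾ s))

  sweep-right : ∀ {q} (g : Bool → List Symbol) →
                (∀ b → τ q ⟪ bit b ⟫ ≡ just (q , right , g b)) →
                ∀ bs ls rs → Run (q , at ls (cells (map bit bs) ++ rs)) (concatMap g bs) (length bs)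
                                 (q , at (cells (map bit bs) ʳ++ ls) rs)
  sweep-right     g e []       ls rs = done
  sweep-right {q} g e (b ∷ bs) ls rs =
    e b then from (move-right ls ⟪ bit b ⟫ _) (sweep-right g e bs (⟪ bit b ⟫ ∷ ls) rs)

  -- The start is given as the result of a left move off `x`, so that for empty `bs` the head is
  -- already on `c`.
  sweep-left : ∀ {q} → (∀ b → τ q ⟪ bit b ⟫ ≡ just (q , left , [])) →
               ∀ bs ls c x rs →
               Run (q , move left (tape (cells (map bit bs) ʳ++ c ∷ ls) x rs)) [] (length bs)
                   (q , tape ls c (cells (map bit bs) ++ x ∷ rs))
  sweep-left e []       ls c x rs = done
  sweep-left e (b ∷ bs) ls c x rs =
    -- The leftmost bit `b` is read last: the sweep over `bs` stops on it, and one more step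
    -- follows.
    weaken (≤-reflexive (+-comm (length bs) 1))
           (sweep-left e bs (c ∷ ls) ⟪ bit b ⟫ x rs ⨾ (e b then done))

  -- The second component counts the symbols already written of the current word.
  Control : Set
  Control = State × Fin (suc bound)

  -- A Turing machine writes one symbol per step. While part of `w` is pending, state and input head
  -- stay put, so `τ` yields the same transition again; once `w` is exhausted the transition takes
  -- effect.
  perform : State → Fin (suc bound) → Cell → State × Move × List Symbol →
            Control × Vec (Cell × Move) 2
  perform q j x (q′ , m , w) with drop (toℕ j) w
  ... | []    = (q′ , zero) , (x , m) ∷ (nothing , stay) ∷ []
  -- Words emitted by `τ` have length at most `bound`, so for them the counter never wraps around;
  -- `mod` only keeps it in `Fin`.
  ... | s ∷ _ = (q , suc (toℕ j) mod suc bound) , (x , stay) ∷ (⟪ s ⟫ , right) ∷ []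

  machine : TuringMachine
  machine = record
    { State     = Control
    ; finite    = _ , ↔-sym *↔× ↔-∘ (proj₂ finite ×-↔ ↔-id _)
    ; start     = start , zero
    ; workTapes = 0
    ; extra     = 0
    ; δ         = λ { (q , j) (x ∷ _ ∷ []) → Maybe.map (perform q j x) (τ q x) }
    }

  open TuringMachine machine using (Configuration; step; _⇓⟨_⟩_; halt; next; Outputs; initial; δ)

  -- The output head rests on the blank after `o`, hence the reversed list to its left.
  config : State → Fin (suc bound) → Tape Letter → List Symbol → Configuration
  config q j t o = (q , j) , t ∷ tape (reverse (cells o)) nothing [] ∷ []

  step-δ : ∀ c ts {c′ as} → δ c (Vec.map Tape.here ts) ≡ just (c′ , as) →
           step (c , ts) ≡ just (c′ , Vec.zipWith act as ts)
  step-δ c ts e rewrite e = refl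

  step-halt : ∀ c ts → δ c (Vec.map Tape.here ts) ≡ nothing → step (c , ts) ≡ nothing
  step-halt c ts e rewrite e = refl

  -- Induction on `u`, the part of the emitted word still to be written after the prefix `v`
  -- recorded by the counter. Each symbol takes one step, and one more step carries out the move.
  write-word : ∀ u v {q j t q′ m n d} o →
               τ q (Tape.here t) ≡ just (q′ , m , v ++ u) → toℕ j ≡ length v →
               config q′ zero (move m t) (o ++ u) ⇓⟨ n ⟩ d →
               config q j t o ⇓⟨ suc (length u) + n ⟩ d
  write-word [] v {q} {j} {t} {q′} {m} o e j≡ r =
    next (step-δ _ _ δ-eq) (subst (λ o′ → config q′ zero (move m t) o′ ⇓⟨ _ ⟩ _) (++-identityʳ o) r)
    where
    δ-eq : Maybe.map (perform q j (Tape.here t)) (τ q (Tape.here t)) ≡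
           just ((q′ , zero) , (Tape.here t , m) ∷ (nothing , stay) ∷ [])
    δ-eq rewrite e | j≡ | drop-length-++ v [] = refl
  write-word (s ∷ u) v {q} {j} {t} {q′} {m} {n} {d} o e j≡ r =
    next (step-δ _ _ δ-eq) (subst (λ o′ → ((q , j′) , t ∷ tape o′ nothing [] ∷ []) ⇓⟨ _ ⟩ _) written
      (write-word u (v ++ [ s ]) (o ++ [ s ])
        (trans e (cong (λ w → just (q′ , m , w)) (sym (++-assoc v [ s ] u)))) j′≡
        (subst (λ o′ → config q′ zero (move m t) o′ ⇓⟨ n ⟩ d) (sym (++-assoc o [ s ] u)) r)))
    where
    j′ : Fin (suc bound)
    j′ = suc (toℕ j) mod suc bound

    δ-eq : Maybe.map (perform q j (Tape.here t)) (τ q (Tape.here t)) ≡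
           just ((q , j′) , (Tape.here t , stay) ∷ (⟪ s ⟫ , right) ∷ [])
    δ-eq rewrite e | cong (λ i → drop i (v ++ s ∷ u)) j≡ | drop-length-++ v (s ∷ u) = refl

    length≡ : length (v ++ s ∷ u) ≡ suc (toℕ j) + length u
    length≡ = trans (length-++ v) (trans (cong (_+ suc (length u)) (sym j≡)) (+-suc _ _))

    j<bound : suc (toℕ j) ≤ bound
    j<bound = ≤-trans (subst (suc (toℕ j) ≤_) (sym length≡) (m≤m+n _ _)) (bounded q (Tape.here t) e)

    j′≡ : toℕ j′ ≡ length (v ++ [ s ])
    j′≡ = begin
      toℕ j′                ≡⟨ toℕ-fromℕ< _ ⟩
      _                     ≡⟨ m<n⇒m%n≡m (s≤s j<bound) ⟩
      suc (toℕ j)           ≡⟨ cong suc j≡ ⟩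
      suc (length v)        ≡⟨ +-comm 1 (length v) ⟩
      length v + 1          ≡⟨ length-++ v ⟨
      length (v ++ [ s ])   ∎
      where open ≡-Reasoning

    written : reverse (cells (o ++ [ s ])) ≡ ⟪ s ⟫ ∷ reverse (cells o)
    written = trans (cong reverse (cells-++ o [ s ])) (reverse-++ (cells o) [ ⟪ s ⟫ ])

  -- A transition that emits `v` takes `1 + length v` machine steps, which is at most `suc bound`.
  simulate : ∀ {q t w n q′ t′} o → Run (q , t) w n (q′ , t′) → τ q′ (Tape.here t′) ≡ nothing →
             ∃ λ s → config q zero t o ⇓⟨ s ⟩ config q′ zero t′ (o ++ w) × s ≤ n * suc bound
  simulate {q} {t} o done e = 0 ,
    subst (λ o′ → config q zero t o ⇓⟨ 0 ⟩ config q zero t o′) (sym (++-identityʳ o))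
      (halt (step-halt _ _ (cong (Maybe.map _) e))) , z≤n
  simulate {q} {t} {q′ = q″} {t′ = t″} o (_then_ {v = v} {w = w} e r) h
    with simulate (o ++ v) r h
  ... | s , r′ , s≤ = _ ,
    write-word v [] o e refl
      (subst (λ o′ → _ ⇓⟨ s ⟩ config q″ zero t″ o′) (++-assoc o v w) r′) ,
    +-mono-≤ (s≤s (bounded q (Tape.here t) e)) s≤

  linear-time : ∀ {f} c →
    (∀ G → ∃₂ λ q t → Run (start , at [] (cells (encode G))) (encode (f G))
                          (c + length (encode G) * c) (q , t)
                    × τ q (Tape.here t) ≡ nothing) →
    PolyTimeComputable f
  linear-time {f} c runs = machine , c * suc bound ∷ c * suc bound ∷ [] , computes
    where
    computes : ∀ G → ∃₂ λ s d → initial (encode G) ⇓⟨ s ⟩ d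
      × s ≤ eval (c * suc bound ∷ c * suc bound ∷ []) (length (encode G))
      × Outputs d (encode (f G))
    computes G with runs G
    ... | q , t , r , h with simulate [] r h
    ... | s , r′ , s≤ = s , config q zero t (encode (f G)) ,
      subst (λ t₀ → ((start , zero) , t₀ ∷ emptyTape ∷ []) ⇓⟨ s ⟩ config q zero t (encode (f G)))
            (sym (load-at (encode G))) r′ ,
      ≤-trans s≤ (≤-reflexive time≡) ,
      -- No blank precedes the output; the single one after it is the cell under the head.
      (0 , 1 , cong (_++ nothing ∷ []) (reverse-involutive (cells (encode (f G)))))
      where
      L = length (encode G)
      B = suc bound
      time≡ : (c + L * c) * B ≡ c * B + L * (c * B + L * 0)
      time≡ = begin
        (c + L * c) * B               ≡⟨ *-distribʳ-+ B c (L * c) ⟩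
        c * B + L * c * B             ≡⟨ cong (c * B +_) (*-assoc L c B) ⟩
        c * B + L * (c * B)           ≡⟨ cong (λ z → c * B + L * z) (+-identityʳ (c * B)) ⟨
        c * B + L * (c * B + 0)       ≡⟨ cong (λ z → c * B + L * (c * B + z)) (*-zeroʳ L) ⟨
        c * B + L * (c * B + L * 0)   ∎
        where open ≡-Reasoning

-- Encodings of graphs

line : List Bool → List Symbol
line bs = map bit bs ++ [ sep ]

matrix : Graph → List (List Bool)
matrix G = tabulate λ u → tabulate (adj G u)

encode-matrix : ∀ G → encode G ≡ concatMap line (matrix G)
encode-matrix G = cong concat (trans
  (tabulate-cong λ u → cong (_++ [ sep ]) (sym (map-tabulate (adj G u) bit)))
  (sym (map-tabulate (λ u → tabulate (adj G u)) line)))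

cells-line : ∀ bs w → cells (line bs ++ w) ≡ cells (map bit bs) ++ ⟪ sep ⟫ ∷ cells w
cells-line bs w = trans (cong cells (++-assoc (map bit bs) [ sep ] w)) (cells-++ (map bit bs) _)

length-line : ∀ bs → length (line bs) ≡ suc (length bs)
length-line bs = trans (length-++ (map bit bs)) (trans (+-comm _ 1) (cong suc (length-map bit bs)))

length-lines : ∀ rows → length rows ≤ length (concatMap line rows)
length-lines []         = z≤n
length-lines (bs ∷ rows) = begin
  suc (length rows)                                  ≤⟨ +-mono-≤ (s≤s (z≤n {length bs})) (length-lines rows) ⟩
  suc (length bs) + length (concatMap line rows)     ≡⟨ cong (_+ _) (length-line bs) ⟨
  length (line bs) + length (concatMap line rows)    ≡⟨ length-++ (line bs) ⟨
  length (line bs ++ concatMap line rows)            ∎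
  where open ≤-Reasoning

order≤length-encode : ∀ G → order G ≤ length (encode G)
order≤length-encode G = subst₂ _≤_ (length-tabulate (λ u → tabulate (adj G u)))
  (cong length (sym (encode-matrix G))) (length-lines (matrix G))

tabulate-+ : ∀ {A : Set} m {n} (f : Fin (m + n) → A) →
             tabulate f ≡ tabulate (f ∘ (_↑ˡ n)) ++ tabulate (f ∘ (m ↑ʳ_))
tabulate-+ zero    f = refl
tabulate-+ (suc m) f = cong (f zero ∷_) (tabulate-+ m (f ∘ suc))

tabulate-const : ∀ {A : Set} n (x : A) → tabulate {n = n} (const x) ≡ replicate n x
tabulate-const zero    x = refl
tabulate-const (suc n) x = cong (x ∷_) (tabulate-const n x)

tabulate-splitAt : ∀ {A : Set} m {n} (f : Fin m ⊎ Fin n → A) →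
                   tabulate (f ∘ splitAt m) ≡ tabulate (f ∘ inj₁) ++ tabulate (f ∘ inj₂)
tabulate-splitAt m f = trans (tabulate-+ m (f ∘ splitAt m)) (cong₂ _++_
  (tabulate-cong λ i → cong f (splitAt-↑ˡ m i _))
  (tabulate-cong λ i → cong f (splitAt-↑ʳ m _ i)))

-- `quotient k` is constant on consecutive blocks of length `k`, so each entry is repeated in place.
tabulate-quotient : ∀ {A : Set} {n} k (f : Fin n → A) →
                    tabulate (f ∘ quotient {n} k) ≡ concatMap (replicate k) (tabulate f)
tabulate-quotient {n = zero}  k f = refl
tabulate-quotient {n = suc n} k f = trans (tabulate-+ k _) (cong₂ _++_
  (trans (tabulate-cong λ i → cong f (cong proj₁ (remQuot-combine {suc n} {k} zero i)))
         (tabulate-const k (f zero)))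
  (trans (tabulate-cong λ i → cong f (quotient-↑ʳ i)) (tabulate-quotient {n = n} k (f ∘ suc))))
  where
  quotient-↑ʳ : ∀ i → quotient {suc n} k (k ↑ʳ i) ≡ suc (quotient {n} k i)
  quotient-↑ʳ i rewrite splitAt-↑ʳ k (n * k) i = refl

-- `inject₁ i` is the form in which downward induction over `Fin` presents its step; the base case
-- is the index `fromℕ n`.
drop-tabulate : ∀ {A : Set} {n} (f : Fin n → A) i →
                drop (toℕ (inject₁ i)) (tabulate f) ≡ f i ∷ drop (suc (toℕ i)) (tabulate f)
drop-tabulate f zero    = refl
drop-tabulate f (suc i) = drop-tabulate (f ∘ suc) i

drop-all-tabulate : ∀ {A : Set} {n} (f : Fin n → A) → drop (toℕ (fromℕ n)) (tabulate f) ≡ []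
drop-all-tabulate {n = zero}  f = refl
drop-all-tabulate {n = suc n} f = drop-all-tabulate (f ∘ suc)

concatMap-const : ∀ {A B : Set} (y : B) (xs : List A) →
                  concatMap (const [ y ]) xs ≡ replicate (length xs) y
concatMap-const y []       = refl
concatMap-const y (_ ∷ xs) = cong (y ∷_) (concatMap-const y xs)

-- Rows are delimited by sep, except that the first one is preceded, and an empty
-- input followed, by a blank.
data Boundary : Cell → Set where
  blank     : Boundary nothing
  separator : Boundary ⟪ sep ⟫

-- Disjoint unions, blow-ups and their adjacency matrices

disjointUnion : Graph → Graph → Graph
disjointUnion H G = record
  { order     = order H + order G
  ; adj       = λ a b → sum-adj (splitAt (order H) a) (splitAt (order H) b)
  ; symmetric = λ a b → sum-sym (splitAt (order H) a) (splitAt (order H) b)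
  }
  module DisjointUnion where
  sum-adj : V H ⊎ V G → V H ⊎ V G → Bool
  sum-adj (inj₁ i) (inj₁ j) = adj H i j
  sum-adj (inj₂ u) (inj₂ v) = adj G u v
  sum-adj _        _        = false

  sum-sym : ∀ x y → sum-adj x y ≡ sum-adj y x
  sum-sym (inj₁ i) (inj₁ j) = symmetric H i j
  sum-sym (inj₁ _) (inj₂ _) = refl
  sum-sym (inj₂ _) (inj₁ _) = refl
  sum-sym (inj₂ u) (inj₂ v) = symmetric G u v

blowUp : ℕ → Graph → Graph
blowUp k G = record
  { order     = order G * k
  ; adj       = λ a b → adj G (quotient k a) (quotient k b)
  ; symmetric = λ a b → symmetric G (quotient k a) (quotient k b)
  }

-- The matrix is block diagonal; the zero blocks pad the rows of `H` on the right and those of `G`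
-- on the left.
matrix-disjointUnion : ∀ H G → matrix (disjointUnion H G) ≡
  map (_++ replicate (order G) false) (matrix H) ++ map (replicate (order H) false ++_) (matrix G)
matrix-disjointUnion H G = trans
  (tabulate-splitAt (order H) (λ x → tabulate (sum-adj x ∘ splitAt (order H))))
  (cong₂ _++_
    (trans (tabulate-cong λ i → trans (tabulate-splitAt (order H) (sum-adj (inj₁ i)))
                                      (cong (tabulate (adj H i) ++_) (tabulate-const (order G) false)))
           (sym (map-tabulate _ _)))
    (trans (tabulate-cong λ u → trans (tabulate-splitAt (order H) (sum-adj (inj₂ u)))
                                      (cong (_++ tabulate (adj G u)) (tabulate-const (order H) false)))
           (sym (map-tabulate _ _))))
  where open DisjointUnion H G

-- This is the Kronecker product with the all-ones matrix of size `k`: rows are stretched, then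
-- repeated.
matrix-blowUp : ∀ k G → matrix (blowUp k G) ≡
  concatMap (replicate k) (map (concatMap (replicate k)) (matrix G))
matrix-blowUp k G = trans
  (tabulate-quotient k (λ u → tabulate (adj G u ∘ quotient k)))
  (cong (concatMap (replicate k)) (trans
    (tabulate-cong λ u → tabulate-quotient k (adj G u))
    (sym (map-tabulate (λ u → tabulate (adj G u)) (concatMap (replicate k))))))

-- Correctness of the reductions

T-does : ∀ {P : Set} (p? : Dec P) → T (does p?) ⇔ P
T-does (yes p) = mk⇔ (λ _ → p) _
T-does (no ¬p) = mk⇔ (λ ()) ¬p

module _ (G H : Graph) (R : Relation (order G) (order H)) where

  ∗-edges⇒adj≡ : (∀ {a b} → ∗-Edge G R a b ⇔ E H a b) → ∀ a b → adj (G ∗ R) a b ≡ adj H a b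
  ∗-edges⇒adj≡ edges a b = does-⇔ edges (∗-Edge? G R a b) (T? (adj H a b))

  adj≡⇒∗-edges : (∀ a b → adj (G ∗ R) a b ≡ adj H a b) → ∀ {a b} → ∗-Edge G R a b ⇔ E H a b
  adj≡⇒∗-edges adj≡ {a} {b} = mk⇔
    (subst T (adj≡ a b) ∘ Equivalence.from (T-does (∗-Edge? G R a b)))
    (Equivalence.to (T-does (∗-Edge? G R a b)) ∘ subst T (sym (adj≡ a b)))

graphOf : ∀ {m n} → (Fin m → Fin n) → Relation m n
graphOf f v b = does (f v ≟ b)

graphOf-⇔ : ∀ {m n} (f : Fin m → Fin n) {v b} → T (graphOf f v b) ⇔ f v ≡ b
graphOf-⇔ f {v} {b} = T-does (f v ≟ b)

-- From homomorphisms to relations with full domain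

module _ (H G : Graph) where
  open DisjointUnion H G

  private
    k : ℕ
    k = order H

    H⊎G : Graph
    H⊎G = disjointUnion H G

    E-inj₁ : ∀ {i j} → E H i j → E H⊎G (i ↑ˡ order G) (j ↑ˡ order G)
    E-inj₁ {i} {j} = subst T (sym
      (cong₂ sum-adj (splitAt-↑ˡ k i (order G)) (splitAt-↑ˡ k j (order G))))

    E-inj₂ : ∀ {u v} → E G u v → E H⊎G (k ↑ʳ u) (k ↑ʳ v)
    E-inj₂ {u} {v} = subst T (sym
      (cong₂ sum-adj (splitAt-↑ʳ k (order G) u) (splitAt-↑ʳ k (order G) v)))

  -- The identity on the copy of `H` already produces all vertices and edges of `H`; that `f` is a
  -- homomorphism says that the copy of `G` adds no other edge.
  Hom⇔FulRel-disjointUnion : Hom H G ⇔ FulRel H H⊎G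
  Hom⇔FulRel-disjointUnion = mk⇔ to from
    where
    to : Hom H G → FulRel H H⊎G
    to (f , isHom) = graphOf g ,
      (λ v → g v , related v refl) , (λ b → b ↑ˡ order G , related _ (g-↑ˡ b)) ,
      ∗-edges⇒adj≡ H⊎G H (graphOf g) (mk⇔ project lift)
      where
      g : V H⊎G → V H
      g a = [ id , f ]′ (splitAt k a)

      g-↑ˡ : ∀ b → g (b ↑ˡ order G) ≡ b
      g-↑ˡ b = cong [ id , f ]′ (splitAt-↑ˡ k b (order G))

      related : ∀ v {b} → g v ≡ b → T (graphOf g v b)
      related v = Equivalence.from (graphOf-⇔ g)

      -- No edge joins the two summands, so the mixed cases are absurd.
      sum-hom : ∀ x y → T (sum-adj x y) → E H ([ id , f ]′ x) ([ id , f ]′ y)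
      sum-hom (inj₁ _) (inj₁ _) e = e
      sum-hom (inj₂ _) (inj₂ _) e = isHom e

      project : ∀ {a b} → ∗-Edge H⊎G (graphOf g) a b → E H a b
      project (u , v , e , ua , vb) = subst₂ (E H)
        (Equivalence.to (graphOf-⇔ g) ua) (Equivalence.to (graphOf-⇔ g) vb)
        (sum-hom (splitAt k u) (splitAt k v) e)

      lift : ∀ {a b} → E H a b → ∗-Edge H⊎G (graphOf g) a b
      lift e = _ , _ , E-inj₁ e , related _ (g-↑ˡ _) , related _ (g-↑ˡ _)

    from : FulRel H H⊎G → Hom H G
    from (R , total , _ , adj≡) = (λ v → proj₁ (total (k ↑ʳ v))) , λ e →
      Equivalence.to (adj≡⇒∗-edges H⊎G H R adj≡) (_ , _ , E-inj₂ e , proj₂ (total _) , proj₂ (total _))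

-- From relations with full domain to surjective homomorphisms

module _ (H G : Graph) where

  private
    k : ℕ
    k = suc (order H)

    Gᵏ : Graph
    Gᵏ = blowUp k G

    E-combine : ∀ {u v} i j → E G u v → E Gᵏ (combine u i) (combine v j)
    E-combine {u} {v} i j = subst T (sym (cong₂ (adj G)
      (cong proj₁ (remQuot-combine u i)) (cong proj₁ (remQuot-combine v j))))

  FulRel⇔SurHom-blowUp : FulRel H G ⇔ SurHom H Gᵏ
  FulRel⇔SurHom-blowUp = mk⇔ to from
    where
    to : FulRel H G → SurHom H Gᵏ
    to (R , total , onto , adj≡) = f , record
      { isHom          = λ e → Equivalence.to (adj≡⇒∗-edges G H R adj≡) (_ , _ , e , f-related _ , f-related _)
      -- Copy `suc b` of a vertex is reserved for the value `b`, taken whenever the vertex is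
      -- related to `b`.
      ; vertices-cover = λ b → combine (proj₁ (onto b)) (suc b) , f-combine (proj₂ (onto b))
      ; edges-cover    = edges-cover
      }
      where
      -- Copy 0 is there for empty H: without it the blow-up of every G would be empty.
      choose : V G × Fin k → V H
      choose (v , zero)  = proj₁ (total v)
      choose (v , suc b) = if R v b then b else proj₁ (total v)

      choose-related : ∀ x → T (R (proj₁ x) (choose x))
      choose-related (v , zero)  = proj₂ (total v)
      choose-related (v , suc b) with R v b in Rvb
      ... | true  = subst T (sym Rvb) _
      ... | false = proj₂ (total v)

      choose-suc : ∀ {v b} → T (R v b) → choose (v , suc b) ≡ b
      choose-suc {v} {b} r with R v b
      ... | true = refl

      f : V Gᵏ → V H
      f a = choose (remQuot k a)

      f-related : ∀ a → T (R (quotient k a) (f a))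
      f-related a = choose-related (remQuot k a)

      f-combine : ∀ {v b} → T (R v b) → f (combine v (suc b)) ≡ b
      f-combine {v} {b} r = trans (cong choose (remQuot-combine v (suc b))) (choose-suc r)

      edges-cover : ∀ {a b} → E H a b → ∃₂ λ x y → E Gᵏ x y × a ≡ f x × b ≡ f y
      edges-cover {a} {b} e with Equivalence.from (adj≡⇒∗-edges G H R adj≡) e
      ... | u , v , uv , ua , vb =
        combine u (suc a) , combine v (suc b) , E-combine (suc a) (suc b) uv ,
        sym (f-combine ua) , sym (f-combine vb)

    from : SurHom H Gᵏ → FulRel H G
    -- Every vertex has a copy `zero`, whose image witnesses full domain.
    from (f , surjective) = R , (λ v → f (combine v zero) , related refl) , onto ,
      ∗-edges⇒adj≡ G H R (mk⇔ project lift)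
      where
      open IsSurjectiveHom surjective

      image? : ∀ v b → Dec (∃ λ i → f (combine v i) ≡ b)
      image? v b = any? λ i → f (combine v i) ≟ b

      R : Relation (order G) (order H)
      R v b = does (image? v b)

      related : ∀ {v i b} → f (combine v i) ≡ b → T (R v b)
      related fvi≡b = Equivalence.from (T-does (image? _ _)) (_ , fvi≡b)

      related-quotient : ∀ {x b} → f x ≡ b → T (R (quotient k x) b)
      related-quotient {x} fx≡b = related (trans (cong f (combine-remQuot {order G} k x)) fx≡b)

      onto : FullImage R
      onto b with vertices-cover b
      ... | x , fx≡b = quotient k x , related-quotient fx≡b

      project : ∀ {a b} → ∗-Edge G R a b → E H a b
      project (u , v , uv , ua , vb)
        with Equivalence.to (T-does (image? u _)) ua | Equivalence.to (T-does (image? v _)) vb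
      ... | i , refl | j , refl = isHom (E-combine i j uv)

      lift : ∀ {a b} → E H a b → ∗-Edge G R a b
      lift e with edges-cover e
      ... | x , y , xy , a≡fx , b≡fy = quotient k x , quotient k y , xy ,
        related-quotient (sym a≡fx) , related-quotient (sym b≡fy)

-- Transducers for the reductions

Fin-⊎ : ∀ {l m n} → (Fin l ⊎ Fin m ⊎ Fin n) ↔ Fin (l + (m + n))
Fin-⊎ {l} {m} {n} = ↔-sym +↔⊎ ↔-∘ (↔-id (Fin l) ⊎-cong ↔-sym (+↔⊎ {m} {n}))

-- The first row serves as a ruler of length `order G`. For the empty graph it is empty, and the
-- blank under the head takes the place of its separator.
first-row : ∀ G → ∃ λ bs → ∃₂ λ d rs →
  at [ nothing ] (cells (encode G)) ≡ at [ nothing ] (cells (map bit bs) ++ d ∷ rs)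
  × length bs ≡ order G × Boundary d
first-row G with order G | adj G | encode-matrix G
... | zero  | _ | e = [] , nothing , [] , cong (at [ nothing ] ∘ cells) e , refl , blank
... | suc n | a | e = tabulate (a zero) , _ , _ ,
  cong (at [ nothing ]) (trans (cong cells e)
    (cells-line (tabulate (a zero)) (concatMap line (tabulate λ u → tabulate (a (suc u)))))) ,
  length-tabulate (a zero) , separator

-- The transducer for the disjoint union

module DisjointUnionMachine (H : Graph) where

  k : ℕ
  k = order H

  State : Set
  State = Fin 3 ⊎ Fin (suc k) ⊎ Fin k

  pattern starting    = inj₁ zero
  pattern row-start   = inj₁ (suc zero)
  pattern copying     = inj₁ (suc (suc zero))
  pattern rewinding i = inj₂ (inj₁ i)
  pattern padding i   = inj₂ (inj₂ i)

  row : V H → List Symbol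
  row i = map bit (tabulate (adj H i))

  -- In `rewinding i` the rows of `H` before `i` have been written, so the top index ends this
  -- phase.
  next-row : {i : Fin (suc k)} → View i → State × Move × List Symbol
  next-row ‵fromℕ       = row-start , right , []
  next-row (‵inject₁ i) = padding i , right , row i

  -- Row i of H is written when leaving rewinding i; the sweep of padding i over the
  -- first row of G then adds the order G zeros that end it.
  τ : State → Cell → Maybe (State × Move × List Symbol)
  τ starting      _           = just (rewinding zero , left , [])
  τ (rewinding i) ⟪ bit _ ⟫   = just (rewinding i , left , [])
  τ (rewinding i) _           = just (next-row (view i))
  τ (padding i)   ⟪ bit _ ⟫   = just (padding i , right , [ bit false ])
  τ (padding i)   _           = just (rewinding (suc i) , left , [ sep ])
  τ row-start     nothing     = nothing
  τ row-start     (just _)    = just (copying , stay , replicate k (bit false))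
  τ copying       ⟪ bit b ⟫   = just (copying , right , [ bit b ])
  τ copying       _           = just (row-start , right , [ sep ])

  next-row-length : {i : Fin (suc k)} (v : View i) → length (proj₂ (proj₂ (next-row v))) ≤ suc k
  next-row-length ‵fromℕ       = z≤n
  next-row-length (‵inject₁ i) =
    m≤n⇒m≤1+n (≤-reflexive (trans (length-map bit (tabulate (adj H i))) (length-tabulate (adj H i))))

  bounded : ∀ q x {q′ m w} → τ q x ≡ just (q′ , m , w) → length w ≤ suc k
  bounded starting      _           refl = z≤n
  bounded (rewinding i) ⟪ bit _ ⟫   refl = z≤n
  bounded (rewinding i) ⟪ sep ⟫     refl = next-row-length (view i)
  bounded (rewinding i) nothing     refl = next-row-length (view i)
  bounded (padding i)   ⟪ bit _ ⟫   refl = s≤s z≤n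
  bounded (padding i)   ⟪ sep ⟫     refl = s≤s z≤n
  bounded (padding i)   nothing     refl = s≤s z≤n
  bounded row-start     (just _)    refl = m≤n⇒m≤1+n (≤-reflexive (length-replicate k))
  bounded copying       ⟪ bit _ ⟫   refl = s≤s z≤n
  bounded copying       ⟪ sep ⟫     refl = s≤s z≤n
  bounded copying       nothing     refl = s≤s z≤n

  transducer : Transducer
  transducer = record
    { finite = _ , Fin-⊎ ; start = starting ; τ = τ ; bound = suc k ; bounded = bounded }

  open Transducer transducer
    using (Run; done; _then_; _⨾_; weaken; from; writing; sweep-left; sweep-right; linear-time)

  -- Downward induction on `i`. A row costs a sweep over the ruler in each direction and a turn at
  -- either end; the last `1` is the step back onto the input.
  rows-of-H : ∀ bs {d} rs → Boundary d → ∀ i →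
    Run (rewinding i , tape [] nothing (cells (map bit bs) ++ d ∷ rs))
        (concatMap line (map (_++ replicate (length bs) false) (drop (toℕ i) (matrix H))))
        (length (drop (toℕ i) (matrix H)) * (2 + 2 * length bs) + 1)
        (row-start , at [ nothing ] (cells (map bit bs) ++ d ∷ rs))
  rows-of-H bs {d} rs boundary = >-weakInduction _ top below
    where
    n = length bs

    Claim : Fin (suc k) → List (List Bool) → Set
    Claim i rows = Run (rewinding i , tape [] nothing (cells (map bit bs) ++ d ∷ rs))
      (concatMap line (map (_++ replicate n false) rows)) (length rows * (2 + 2 * n) + 1)
      (row-start , at [ nothing ] (cells (map bit bs) ++ d ∷ rs))

    top : Claim (fromℕ k) (drop (toℕ (fromℕ k)) (matrix H))
    top = subst (Claim (fromℕ k)) (sym (drop-all-tabulate (λ u → tabulate (adj H u))))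
      (cong (just ∘ next-row) (view-fromℕ k) then from (move-right [] nothing _) done)

    turn : ∀ {d} i → Boundary d → τ (padding i) d ≡ just (rewinding (suc i) , left , [ sep ])
    turn i blank     = refl
    turn i separator = refl

    output : ∀ (xs : List Bool) w →
      map bit xs ++ concatMap (const [ bit false ]) bs ++ sep ∷ w ≡ line (xs ++ replicate n false) ++ w
    output xs w = begin
      map bit xs ++ concatMap (const [ bit false ]) bs ++ sep ∷ w
        ≡⟨ cong (λ z → map bit xs ++ z ++ sep ∷ w) (concatMap-const (bit false) bs) ⟩
      map bit xs ++ replicate n (bit false) ++ sep ∷ w
        ≡⟨ ++-assoc (map bit xs) _ _ ⟨
      (map bit xs ++ replicate n (bit false)) ++ sep ∷ w
        ≡⟨ cong (λ z → (map bit xs ++ z) ++ sep ∷ w) (map-replicate bit n false) ⟨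
      (map bit xs ++ map bit (replicate n false)) ++ sep ∷ w
        ≡⟨ cong (_++ sep ∷ w) (map-++ bit xs _) ⟨
      map bit (xs ++ replicate n false) ++ sep ∷ w
        ≡⟨ ++-assoc (map bit (xs ++ replicate n false)) [ sep ] w ⟨
      line (xs ++ replicate n false) ++ w ∎
      where open ≡-Reasoning

    steps : ∀ n m → suc (n + suc (n + (m * (2 + 2 * n) + 1))) ≡ suc m * (2 + 2 * n) + 1
    steps = solve-∀

    below : ∀ i → Claim (suc i) (drop (suc (toℕ i)) (matrix H)) →
            Claim (inject₁ i) (drop (toℕ (inject₁ i)) (matrix H))
    below i rest = subst (Claim (inject₁ i)) (sym (drop-tabulate (λ u → tabulate (adj H u)) i))
      (writing (output (tabulate (adj H i)) _)
      (weaken (≤-reflexive (steps n (length (drop (suc (toℕ i)) (matrix H)))))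
        (cong (just ∘ next-row) (view-inject₁ i) then
         from (move-right [] nothing _)
           (sweep-right (const [ bit false ]) (λ _ → refl) bs [ nothing ] (d ∷ rs) ⨾
            (turn i boundary then
             (sweep-left (λ _ → refl) bs [] nothing d rs ⨾ rest))))))

  -- A row of `n` bits takes `n + 2` transitions: one for all leading zeros, one per bit and one for
  -- the separator. This is at most twice the length of its line.
  rows-of-G : ∀ rows ls → ∃ λ ls′ →
    Run (row-start , at ls (cells (concatMap line rows)))
        (concatMap line (map (replicate k false ++_) rows))
        (length (concatMap line rows) * 2)
        (row-start , at ls′ [])
  rows-of-G []          ls = ls , done
  rows-of-G (bs ∷ rows) ls with rows-of-G rows (⟪ sep ⟫ ∷ (cells (map bit bs) ʳ++ ls))
  ... | ls′ , rest = ls′ ,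
    from (cong (at ls) (cells-line bs (concatMap line rows))) (writing (output _)
      (weaken steps
        (nonblank bs then
         (sweep-right (λ b → [ bit b ]) (λ _ → refl) bs ls (⟪ sep ⟫ ∷ rest-cells) ⨾
          (refl then from (move-right _ _ rest-cells) rest)))))
    where
    rest-cells = cells (concatMap line rows)

    -- Even a line without bits has its separator, so a blank seen in `row-start` marks the end of
    -- the input.
    nonblank : ∀ bs → τ row-start (Tape.here (at ls (cells (map bit bs) ++ ⟪ sep ⟫ ∷ rest-cells))) ≡
                      just (copying , stay , replicate k (bit false))
    nonblank []      = refl
    nonblank (_ ∷ _) = refl

    output : ∀ w → replicate k (bit false) ++ concatMap (λ b → [ bit b ]) bs ++ sep ∷ w ≡
                   line (replicate k false ++ bs) ++ w
    output w = begin
      replicate k (bit false) ++ concatMap ([_] ∘ bit) bs ++ sep ∷ w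
        ≡⟨ cong₂ (λ y z → y ++ z ++ sep ∷ w) (sym (map-replicate bit k false))
             (trans (sym (concatMap-map [_] bit bs)) (concatMap-pure (map bit bs))) ⟩
      map bit (replicate k false) ++ map bit bs ++ sep ∷ w
        ≡⟨ ++-assoc (map bit (replicate k false)) _ _ ⟨
      (map bit (replicate k false) ++ map bit bs) ++ sep ∷ w
        ≡⟨ cong (_++ sep ∷ w) (map-++ bit (replicate k false) bs) ⟨
      map bit (replicate k false ++ bs) ++ sep ∷ w
        ≡⟨ ++-assoc (map bit (replicate k false ++ bs)) [ sep ] w ⟨
      line (replicate k false ++ bs) ++ w ∎
      where open ≡-Reasoning

    steps : suc (length bs + suc (length (concatMap line rows) * 2)) ≤
            length (line bs ++ concatMap line rows) * 2
    steps = begin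
      suc (n + suc (m * 2))       ≤⟨ m≤m+n _ n ⟩
      suc (n + suc (m * 2)) + n   ≡⟨ arithmetic n m ⟩
      (suc n + m) * 2             ≡⟨ cong (λ z → (z + m) * 2) (length-line bs) ⟨
      (length (line bs) + m) * 2  ≡⟨ cong (_* 2) (length-++ (line bs)) ⟨
      length (line bs ++ concatMap line rows) * 2 ∎
      where
      open ≤-Reasoning
      n = length bs
      m = length (concatMap line rows)
      arithmetic : ∀ n m → suc (n + suc (m * 2)) + n ≡ (suc n + m) * 2
      arithmetic = solve-∀

  computable : PolyTimeComputable (disjointUnion H)
  computable = linear-time {disjointUnion H} (2 + 2 * k) runs
    where
    runs : ∀ G → ∃₂ λ q t → Run (starting , at [] (cells (encode G))) (encode (disjointUnion H G))
                                (2 + 2 * k + length (encode G) * (2 + 2 * k)) (q , t)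
                          × τ q (Tape.here t) ≡ nothing
    runs G with first-row G | rows-of-G (matrix G) [ nothing ]
    ... | bs , d , rs , tape≡ , n≡ , boundary | ls , rest = row-start , at ls [] , run , refl
      where
      L = length (encode G)

      prelude : move left (at [] (cells (encode G))) ≡ tape [] nothing (cells (map bit bs) ++ d ∷ rs)
      prelude = trans (move-left-blank (cells (encode G)))
        (trans (cong (move left) tape≡) (move-left-at [] nothing (cells (map bit bs)) d rs))

      arithmetic : ∀ k L → suc (k * (2 + 2 * L) + 1 + L * 2) ≡ 2 + 2 * k + L * (2 + 2 * k)
      arithmetic = solve-∀

      steps : suc (length (matrix H) * (2 + 2 * length bs) + 1 + length (concatMap line (matrix G)) * 2)
              ≤ 2 + 2 * k + L * (2 + 2 * k)
      steps = begin
        suc (length (matrix H) * (2 + 2 * length bs) + 1 + length (concatMap line (matrix G)) * 2)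
          ≡⟨ cong₂ (λ h l → suc (h * (2 + 2 * length bs) + 1 + l * 2))
               (length-tabulate (λ u → tabulate (adj H u))) (cong length (sym (encode-matrix G))) ⟩
        suc (k * (2 + 2 * length bs) + 1 + L * 2)
          ≤⟨ s≤s (+-monoˡ-≤ (L * 2) (+-monoˡ-≤ 1 (*-monoʳ-≤ k (+-monoʳ-≤ 2 (*-monoʳ-≤ 2
               (≤-trans (≤-reflexive n≡) (order≤length-encode G))))))) ⟩
        suc (k * (2 + 2 * L) + 1 + L * 2)
          ≡⟨ arithmetic k L ⟩
        2 + 2 * k + L * (2 + 2 * k) ∎
        where open ≤-Reasoning

      output : concatMap line (map (_++ replicate (length bs) false) (matrix H)) ++
               concatMap line (map (replicate k false ++_) (matrix G)) ≡ encode (disjointUnion H G)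
      output = begin
        concatMap line (map (_++ replicate (length bs) false) (matrix H)) ++ _
          ≡⟨ cong (λ n → concatMap line (map (_++ replicate n false) (matrix H)) ++ _) n≡ ⟩
        concatMap line (map (_++ replicate (order G) false) (matrix H)) ++ _
          ≡⟨ concatMap-++ line (map (_++ replicate (order G) false) (matrix H)) _ ⟨
        concatMap line (map (_++ replicate (order G) false) (matrix H) ++ map (replicate k false ++_) (matrix G))
          ≡⟨ cong (concatMap line) (matrix-disjointUnion H G) ⟨
        concatMap line (matrix (disjointUnion H G))
          ≡⟨ encode-matrix (disjointUnion H G) ⟨
        encode (disjointUnion H G) ∎
        where open ≡-Reasoning

      run : Run (starting , at [] (cells (encode G))) (encode (disjointUnion H G))
                (2 + 2 * k + L * (2 + 2 * k)) (row-start , at ls [])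
      run = writing output (weaken steps (refl then
        (from prelude (rows-of-H bs rs boundary zero) ⨾
         from (trans (sym tape≡) (cong (at [ nothing ] ∘ cells) (encode-matrix G))) rest)))

-- The transducer for the blow-up

module BlowUpMachine (h : ℕ) where

  k : ℕ
  k = suc h

  State : Set
  State = Fin 1 ⊎ Fin k ⊎ Fin k

  pattern starting    = inj₁ zero
  pattern rewinding i = inj₂ (inj₁ i)
  pattern copying i   = inj₂ (inj₂ i)

  end-of-row : Fin k → State × Move × List Symbol
  end-of-row zero    = copying (fromℕ h) , right , [ sep ]
  end-of-row (suc i) = rewinding (inject₁ i) , left , [ sep ]

  -- In copying i, the current row is still to be written toℕ i + 1 times.
  τ : State → Cell → Maybe (State × Move × List Symbol)
  τ starting      _         = just (rewinding (fromℕ h) , left , [])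
  τ (rewinding i) ⟪ bit _ ⟫ = just (rewinding i , left , [])
  τ (rewinding i) _         = just (copying i , right , [])
  τ (copying i)   ⟪ bit b ⟫ = just (copying i , right , replicate k (bit b))
  τ (copying i)   ⟪ sep ⟫   = just (end-of-row i)
  τ (copying i)   nothing   = nothing

  bounded : ∀ q x {q′ m w} → τ q x ≡ just (q′ , m , w) → length w ≤ k
  bounded starting          _         refl = z≤n
  bounded (rewinding i)     ⟪ bit _ ⟫ refl = z≤n
  bounded (rewinding i)     ⟪ sep ⟫   refl = z≤n
  bounded (rewinding i)     nothing   refl = z≤n
  bounded (copying i)       ⟪ bit b ⟫ refl = ≤-reflexive (length-replicate k)
  bounded (copying zero)    ⟪ sep ⟫   refl = s≤s z≤n
  bounded (copying (suc i)) ⟪ sep ⟫   refl = s≤s z≤n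

  transducer : Transducer
  transducer = record
    { finite = _ , Fin-⊎ ; start = starting ; τ = τ ; bound = k ; bounded = bounded }

  open Transducer transducer
    using (Run; done; _then_; _⨾_; weaken; from; writing; sweep-left; sweep-right; linear-time)

  stretch : List Bool → List Bool
  stretch = concatMap (replicate k)

  -- Induction on the countdown `i`. Each copy but the last is followed by a sweep back to the
  -- boundary `c`; the last one crosses the separator and resets the countdown to `fromℕ h`.
  copy-row : ∀ bs {c} ls rs → Boundary c → ∀ i →
    Run (copying i , at (c ∷ ls) (cells (map bit bs) ++ ⟪ sep ⟫ ∷ rs))
        (concatMap line (replicate (suc (toℕ i)) (stretch bs)))
        (suc (toℕ i) * (2 + 2 * length bs))
        (copying (fromℕ h) , at (⟪ sep ⟫ ∷ (cells (map bit bs) ʳ++ c ∷ ls)) rs)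
  copy-row bs {c} ls rs boundary = <-weakInduction _ last earlier
    where
    n = length bs

    Claim : Fin k → ℕ → Set
    Claim i m = Run (copying i , at (c ∷ ls) (cells (map bit bs) ++ ⟪ sep ⟫ ∷ rs))
      (concatMap line (replicate (suc m) (stretch bs))) (suc m * (2 + 2 * n))
      (copying (fromℕ h) , at (⟪ sep ⟫ ∷ (cells (map bit bs) ʳ++ c ∷ ls)) rs)

    turn : ∀ {c} i → Boundary c → τ (rewinding i) c ≡ just (copying i , right , [])
    turn i blank     = refl
    turn i separator = refl

    output : ∀ w → concatMap (λ b → replicate k (bit b)) bs ++ sep ∷ w ≡ line (stretch bs) ++ w
    output w = begin
      concatMap (λ b → replicate k (bit b)) bs ++ sep ∷ w
        ≡⟨ cong (_++ sep ∷ w) (concatMap-cong (λ b → sym (map-replicate bit k b)) bs) ⟩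
      concatMap (map bit ∘ replicate k) bs ++ sep ∷ w
        ≡⟨ cong (_++ sep ∷ w) (map-concatMap bit (replicate k) bs) ⟨
      map bit (stretch bs) ++ sep ∷ w
        ≡⟨ ++-assoc (map bit (stretch bs)) [ sep ] w ⟨
      line (stretch bs) ++ w ∎
      where open ≡-Reasoning

    arithmetic₀ : ∀ n → n + 1 + suc n ≡ 1 * (2 + 2 * n)
    arithmetic₀ = solve-∀

    arithmetic : ∀ n m → n + suc (n + suc (suc m * (2 + 2 * n))) ≡ suc (suc m) * (2 + 2 * n)
    arithmetic = solve-∀

    last : Claim zero 0
    last = writing (output [])
      -- The last copy needs no sweep back; the slack of `suc n` keeps the bound uniform.
      (weaken (≤-trans (m≤m+n (n + 1) (suc n)) (≤-reflexive (arithmetic₀ n)))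
        (sweep-right (λ b → replicate k (bit b)) (λ _ → refl) bs (c ∷ ls) (⟪ sep ⟫ ∷ rs) ⨾
         (refl then from (move-right _ ⟪ sep ⟫ rs) done)))

    earlier : ∀ i → Claim (inject₁ i) (toℕ (inject₁ i)) → Claim (suc i) (suc (toℕ i))
    earlier i rest = writing (output _) (weaken (≤-reflexive (arithmetic n (toℕ i)))
      (sweep-right (λ b → replicate k (bit b)) (λ _ → refl) bs (c ∷ ls) (⟪ sep ⟫ ∷ rs) ⨾
       (refl then
        (sweep-left (λ _ → refl) bs ls c ⟪ sep ⟫ rs ⨾
         (turn (inject₁ i) boundary then
          from (move-right ls c _) (subst (Claim (inject₁ i)) (toℕ-inject₁ i) rest))))))

  copy-rows : ∀ rows {c} ls → Boundary c → ∃ λ ls′ →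
    Run (copying (fromℕ h) , at (c ∷ ls) (cells (concatMap line rows)))
        (concatMap line (concatMap (replicate k) (map stretch rows)))
        (length (concatMap line rows) * (2 * k))
        (copying (fromℕ h) , at ls′ [])
  copy-rows []          ls _ = _ , done
  -- The separator ending this row is the left boundary of the next.
  copy-rows (bs ∷ rows) {c} ls boundary with copy-rows rows (cells (map bit bs) ʳ++ c ∷ ls) separator
  ... | ls′ , rest = ls′ ,
    from (cong (at (c ∷ ls)) (cells-line bs (concatMap line rows)))
      (writing (sym (concatMap-++ line (replicate k (stretch bs)) _))
      (weaken (≤-reflexive steps)
        (subst (λ m → Run (copying (fromℕ h) , at (c ∷ ls) (cells (map bit bs) ++ ⟪ sep ⟫ ∷ rest-cells))
                          (concatMap line (replicate (suc m) (stretch bs))) (suc m * (2 + 2 * length bs))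
                          (copying (fromℕ h) , at (⟪ sep ⟫ ∷ (cells (map bit bs) ʳ++ c ∷ ls)) rest-cells))
           (toℕ-fromℕ h) (copy-row bs ls rest-cells boundary (fromℕ h)) ⨾ rest)))
    where
    rest-cells = cells (concatMap line rows)

    arithmetic : ∀ k n m → k * (2 + 2 * n) + m * (2 * k) ≡ (suc n + m) * (2 * k)
    arithmetic = solve-∀

    steps : k * (2 + 2 * length bs) + length (concatMap line rows) * (2 * k) ≡
            length (line bs ++ concatMap line rows) * (2 * k)
    steps = trans (arithmetic k (length bs) (length (concatMap line rows))) (cong (_* (2 * k))
      (trans (cong (_+ length (concatMap line rows)) (sym (length-line bs))) (sym (length-++ (line bs)))))

  computable : PolyTimeComputable (blowUp k)
  computable = linear-time {blowUp k} (2 * k) runs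
    where
    runs : ∀ G → ∃₂ λ q t → Run (starting , at [] (cells (encode G))) (encode (blowUp k G))
                                (2 * k + length (encode G) * (2 * k)) (q , t)
                          × τ q (Tape.here t) ≡ nothing
    runs G with copy-rows (matrix G) [] blank
    ... | ls , rest = copying (fromℕ h) , at ls [] , run , refl
      where
      L = length (encode G)

      -- The initial detour to the left turns the blank before the input into a stored cell, which
      -- then bounds the first row.
      at-blank : ∀ xs → τ (rewinding (fromℕ h)) (Tape.here (move left (at [] xs))) ≡
                        just (copying (fromℕ h) , right , [])
      at-blank []      = refl
      at-blank (_ ∷ _) = refl

      return : ∀ xs → move right (move left (at [] xs)) ≡ at [ nothing ] xs
      return []      = refl
      return (_ ∷ _) = refl

      output : concatMap line (concatMap (replicate k) (map stretch (matrix G))) ≡ encode (blowUp k G)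
      output = trans (cong (concatMap line) (sym (matrix-blowUp k G))) (sym (encode-matrix (blowUp k G)))

      arithmetic : ∀ h l → 2 + l * (2 * suc h) + 2 * h ≡ 2 * suc h + l * (2 * suc h)
      arithmetic = solve-∀

      steps : 2 + length (concatMap line (matrix G)) * (2 * k) ≤ 2 * k + L * (2 * k)
      steps = ≤-trans (m≤m+n _ (2 * h)) (≤-reflexive (trans (arithmetic h (length (concatMap line (matrix G))))
        (cong (λ w → 2 * k + length w * (2 * k)) (sym (encode-matrix G)))))

      run : Run (starting , at [] (cells (encode G))) (encode (blowUp k G))
                (2 * k + L * (2 * k)) (copying (fromℕ h) , at ls [])
      run = writing output (weaken steps (refl then at-blank (cells (encode G)) then
        from (trans (return (cells (encode G))) (cong (at [ nothing ] ∘ cells) (encode-matrix G))) rest))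

theorem4p5p1 : (H : Graph) → (Hom H ≤ₚ FulRel H) × (FulRel H ≤ₚ SurHom H)
theorem4p5p1 H =
  (disjointUnion H , DisjointUnionMachine.computable H , Hom⇔FulRel-disjointUnion H) ,
  (blowUp (suc (order H)) , BlowUpMachine.computable (order H) , FulRel⇔SurHom-blowUp H)
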